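{- Let $k\equiv\pm2,\pm4\pmod{10}$. Then $\operatorname{Ker}\nu_{G^k}=\{M=\begin{pmatrix} a&b\\ c&d\end{pmatrix}\in\Gamma_{\theta,5}: (b,c\in5\mathbb{Z}\text{ and }\tfrac b5\equiv\tfrac c5\pmod5)\text{ or }(a,d\in5\mathbb{Z}\text{ and }\tfrac a5\equiv-\tfrac d5\pmod5)\}$; in particular $\operatorname{Ker}\nu_{G^k}=\operatorname{Ker}\nu_{F^k}$.
   Context: $\Gamma_{\theta,5}=\{M\in SL(2,\mathbb{Z}): M\equiv\pm\begin{pmatrix}1&0\\0&1\end{pmatrix}\text{ or }\pm\begin{pmatrix}0&-1\\1&0\end{pmatrix}\pmod 5\}$. For $M=\begin{pmatrix} a&b\\ c&d\end{pmatrix}\in\Gamma_{\theta,5}$ define $g(M)=\frac{6b}{5}+\frac{2ab}{5}+\frac{2cd}{5}$ if $M\equiv I$, $\frac{24b}{5}+\frac{2ab}{5}+\frac{2cd}{5}$ if $M\equiv -I$, $5+\frac{6d}{5}+\frac{2ab}{5}+\frac{2cd}{5}$ if $M\equiv\begin{pmatrix}0&-1\\1&0\end{pmatrix}$, $5-\frac{6d}{5}+\frac{2ab}{5}+\frac{2cd}{5}$ if $M\equiv\begin{pmatrix}0&1\\-1&0\end{pmatrix}$ (all mod 5), and $f(M)$ by the same case split with values $\frac{4b}{5}+\frac{8ab}{5}+\frac{8cd}{5}$, $\frac{6b}{5}+\frac{8ab}{5}+\frac{8cd}{5}$, $5+\frac{4d}{5}+\frac{8ab}{5}+\frac{8cd}{5}$,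 $5-\frac{4d}{5}+\frac{8ab}{5}+\frac{8cd}{5}$ respectively. For $k\in\mathbb{Z}$, $\nu_{G^k}(M)=\exp(\frac{\pi ik}{5}g(M))$ and $\nu_{F^k}(M)=\exp(\frac{\pi ik}{5}f(M))$; these are the multiplier systems (weight $2k$) of $G^k$ and $F^k$, where $G=\eta^6/\big(\theta\begin{bmatrix}3/5\\3/5\end{bmatrix}\theta\begin{bmatrix}3/5\\7/5\end{bmatrix}\big)$, $F=\eta^6/\big(\theta\begin{bmatrix}1/5\\1/5\end{bmatrix}\theta\begin{bmatrix}1/5\\9/5\end{bmatrix}\big)$, with theta constants $\theta\begin{bmatrix}\epsilon\\ \epsilon'\end{bmatrix}=\sum_{n\in\mathbb{Z}}\exp(2\pi i[\frac12(n+\frac\epsilon2)^2\tau+(n+\frac\epsilon2)\frac{\epsilon'}2])$ and $\eta(\tau)=q^{1/24}\prod_{n\ge1}(1-q^n)$. Kernels are $\{M\in\Gamma_{\theta,5}:\nu(M)=1\}$. -}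

module Defs where

open import Level using (Level; _⊔_; suc)
open import Data.Integer using (ℤ; +_; 0ℤ; 1ℤ; -1ℤ)
open import Data.Integer.Divisibility.Signed using (_∣_)
open import Data.Rational using (ℚ; _/_)
open import Data.Product using (_×_; ∃; ∃₂)
open import Relation.Binary.PropositionalEquality using (_≡_)
open import Relation.Unary using (Pred)
open import Function.Bundles using (_⇔_)
open import Algebra.Apartness.Bundles using (HeytingField; module HeytingCommutativeRing)
open import Algebra.Morphism.Structures using (module RingMorphisms)
import Algebra.Bundles as Bundles
import Data.Integer as ℤ
import Data.Rational as ℚ

infix 4 _≋_[mod_] _≋ᴹ_[mod_]

_≋_[mod_] : ℤ → ℤ → ℤ → Set
x ≋ y [mod m ] = m ∣ (x ℤ.- y)

record Mat₂ : Set where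
  constructor mat
  field
    a b c d : ℤ

_≋ᴹ_[mod_] : Mat₂ → Mat₂ → ℤ → Set
mat a b c d ≋ᴹ mat a′ b′ c′ d′ [mod m ] =
  a ≋ a′ [mod m ] × b ≋ b′ [mod m ] × c ≋ c′ [mod m ] × d ≋ d′ [mod m ]

negᴹ : Mat₂ → Mat₂
negᴹ (mat a b c d) = mat (ℤ.- a) (ℤ.- b) (ℤ.- c) (ℤ.- d)

I S : Mat₂
I = mat 1ℤ 0ℤ 0ℤ 1ℤ
S = mat 0ℤ -1ℤ 1ℤ 0ℤ

record SL₂ℤ : Set where
  field
    matrix : Mat₂
  open Mat₂ matrix public
  field
    det≡1 : a ℤ.* d ℤ.- b ℤ.* c ≡ 1ℤ

-- The four cases are mutually exclusive, so a definition by cases on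
-- `Residue M` is a definition by cases on M modulo 5.
data Residue (M : Mat₂) : Set where
  ≋I  : M ≋ᴹ I      [mod + 5 ] → Residue M
  ≋-I : M ≋ᴹ negᴹ I [mod + 5 ] → Residue M
  ≋S  : M ≋ᴹ S      [mod + 5 ] → Residue M
  ≋-S : M ≋ᴹ negᴹ S [mod + 5 ] → Residue M

record Γθ₅ : Set where
  field
    element : SL₂ℤ
  open SL₂ℤ element public
  field
    residue : Residue matrix

g : Γθ₅ → ℚ
g M = cases residue
  where
  open Γθ₅ M
  common : ℚ
  common = (+ 2 ℤ.* a ℤ.* b) / 5 ℚ.+ (+ 2 ℤ.* c ℤ.* d) / 5
  cases : Residue matrix → ℚ
  cases (≋I _)  = (+ 6 ℤ.* b) / 5 ℚ.+ common
  cases (≋-I _) = (+ 24 ℤ.* b) / 5 ℚ.+ common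
  cases (≋S _)  = (+ 5 / 1 ℚ.+ (+ 6 ℤ.* d) / 5) ℚ.+ common
  cases (≋-S _) = (+ 5 / 1 ℚ.- (+ 6 ℤ.* d) / 5) ℚ.+ common

f : Γθ₅ → ℚ
f M = cases residue
  where
  open Γθ₅ M
  common : ℚ
  common = (+ 8 ℤ.* a ℤ.* b) / 5 ℚ.+ (+ 8 ℤ.* c ℤ.* d) / 5
  cases : Residue matrix → ℚ
  cases (≋I _)  = (+ 4 ℤ.* b) / 5 ℚ.+ common
  cases (≋-I _) = (+ 6 ℤ.* b) / 5 ℚ.+ common
  cases (≋S _)  = (+ 5 / 1 ℚ.+ (+ 4 ℤ.* d) / 5) ℚ.+ common
  cases (≋-S _) = (+ 5 / 1 ℚ.- (+ 4 ℤ.* d) / 5) ℚ.+ common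

-- The complex numbers with their exponential are not in the standard library.
-- They enter as an arbitrary field of characteristic zero containing a square
-- root i of -1, with an exponential map that turns sums into products and
-- whose kernel is 2πiℤ, π ≠ 0.  (ℂ, exp, π, i) is one such structure; the
-- kernel condition is the classical characterisation of π up to sign.
record ComplexExponential (c ℓ₁ ℓ₂ : Level) : Set (suc (c ⊔ ℓ₁ ⊔ ℓ₂)) where
  field
    heytingField : HeytingField c ℓ₁ ℓ₂

  open HeytingField heytingField public
    using (Carrier; _≈_; _#_; _+_; _*_; -_; 0#; 1#; heytingCommutativeRing)
  open Bundles.CommutativeRing
    (HeytingCommutativeRing.commutativeRing
      heytingCommutativeRing) public
    using (rawRing)
  open RingMorphisms ℚ.+-*-rawRing rawRing using (IsRingMonomorphism)

  field
    fromℚ              : ℚ → Carrier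
    fromℚ-monomorphism : IsRingMonomorphism fromℚ

    i      : Carrier
    i*i≈-1 : i * i ≈ - 1#

    π   : Carrier
    π#0 : π # 0#

    exp        : Carrier → Carrier
    exp-cong   : ∀ {z w} → z ≈ w → exp z ≈ exp w
    exp-+      : ∀ z w → exp (z + w) ≈ exp z * exp w
    exp-kernel : ∀ z → exp z ≈ 1# ⇔ ∃ λ (n : ℤ) → z ≈ fromℚ (+ 2 / 1) * π * i * fromℚ (n / 1)

module Multipliers {c ℓ₁ ℓ₂} (ℂ : ComplexExponential c ℓ₁ ℓ₂) where
  open ComplexExponential ℂ

  νG^ νF^ : ℤ → Γθ₅ → Carrier
  νG^ k M = exp (π * i * fromℚ (k / 5) * fromℚ (g M))
  νF^ k M = exp (π * i * fromℚ (k / 5) * fromℚ (f M))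

  Ker : (Γθ₅ → Carrier) → Pred Γθ₅ ℓ₁
  Ker ν M = ν M ≈ 1#

-- x′ and y′ are x / 5 and y / 5.
FifthsCongruent : ℤ → ℤ → Set
FifthsCongruent x y =
  ∃₂ λ x′ y′ → x ≡ + 5 ℤ.* x′ × y ≡ + 5 ℤ.* y′ × x′ ≋ y′ [mod + 5 ]

FifthsOpposite : ℤ → ℤ → Set
FifthsOpposite x y =
  ∃₂ λ x′ y′ → x ≡ + 5 ℤ.* x′ × y ≡ + 5 ℤ.* y′ × x′ ≋ ℤ.- y′ [mod + 5 ]

{-# OPTIONS --safe #-}
-- Multiplying the exponents by 5 gives integers G(M) and F(M) with
-- g(M) = G(M)/5 and f(M) = F(M)/5, so ν(M) = 1 says that 50 divides k G(M).
-- Since k is even and prime to 5, this means that 25 divides G(M).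
-- Writing the entries of M as 5a′, 5b′, … plus their residues ε = ±1 or 0,
-- one finds modulo 25 that G(M) and F(M) equal 5m(b′ − c′) in the diagonal
-- cases and 5m(a′ + d′) in the antidiagonal ones, with m prime to 5.
module Submission where

open import Defs
open import Level using (Level)
open import Data.Integer using (ℤ; +_; -_; 0ℤ; 1ℤ; -1ℤ; _+_; _*_; _-_)
open import Data.Integer.Divisibility.Signed
open import Data.Integer.Properties using (abs-*; *-comm; *-identityʳ; +-identityˡ;
  neg-distribˡ-*; neg-involutive)
open import Data.Integer.Tactic.RingSolver using (solve-∀)
import Data.Nat.Divisibility as ℕ
open import Data.Nat.Primality using (prime?; euclidsLemma)
open import Data.Product using (_×_; _,_; ∃)
open import Data.Rational as ℚ using (ℚ; _/_; toℚᵘ; fromℚᵘ)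
import Data.Rational.Properties as ℚ
import Data.Rational.Unnormalised as ℚᵘ
import Data.Rational.Unnormalised.Properties as ℚᵘ
open import Data.Sum using (_⊎_; inj₁; inj₂; [_,_]′)
open import Algebra.Apartness.Bundles using (module HeytingCommutativeRing)
import Algebra.Apartness.Properties.HeytingCommutativeRing as HeytingProperties
import Algebra.Properties.Ring as RingProperties
open import Algebra.Bundles using (module CommutativeRing)
open import Algebra.Morphism.Structures using (module RingMorphisms)
open import Function using (_⇔_; mk⇔; _∘_; module Equivalence)
open import Function.Construct.Composition using (_⇔-∘_)
open import Relation.Binary.PropositionalEquality
  using (_≡_; refl; sym; trans; cong; subst)
import Relation.Binary.Reasoning.Setoid as ≈-Reasoning
open import Relation.Nullary using (¬_; contradiction)
open import Relation.Nullary.Decidable using (from-yes; from-no)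
open import Relation.Unary using (_≐_)

open Equivalence using (to; from)

-- Divisibility

∣-m⇒∣m : ∀ {i m} → i ∣ - m → i ∣ m
∣-m⇒∣m {m = m} i∣-m = subst (_ ∣_) (neg-involutive m) (∣m⇒∣-m i∣-m)

5∣m*n⇒5∣n : ∀ m n → ¬ + 5 ∣ m → + 5 ∣ m * n → + 5 ∣ n
5∣m*n⇒5∣n m n 5∤m 5∣mn
  with euclidsLemma _ _ (from-yes (prime? 5)) (subst (5 ℕ.∣_) (abs-* m n) (∣⇒∣ᵤ 5∣mn))
... | inj₁ 5∣m = contradiction (∣ᵤ⇒∣ 5∣m) 5∤m
... | inj₂ 5∣n = ∣ᵤ⇒∣ 5∣n

-- The shape into which every residue case expands: `m` is a unit modulo 5, and `y` collects all
-- terms that vanish modulo 25.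
25∣5m*x+25y⇔5∣x : ∀ m x y → ¬ + 5 ∣ m → + 25 ∣ + 5 * (m * x) + + 25 * y ⇔ + 5 ∣ x
25∣5m*x+25y⇔5∣x m x y 5∤m = mk⇔ forward backward
  where
  25∣25y : + 25 ∣ + 25 * y
  25∣25y = ∣m⇒∣m*n y ∣-refl

  forward : + 25 ∣ + 5 * (m * x) + + 25 * y → + 5 ∣ x
  forward h = 5∣m*n⇒5∣n m x 5∤m (*-cancelˡ-∣ (+ 5) (∣m+n∣n⇒∣m {m = + 5 * (m * x)} h 25∣25y))

  backward : + 5 ∣ x → + 25 ∣ + 5 * (m * x) + + 25 * y
  backward h = ∣m∣n⇒∣m+n (*-monoʳ-∣ (+ 5) (∣n⇒∣m*n m h)) 25∣25y

-- Since `k` is prime to 5, Euclid's lemma applies twice: first to get `n` = 5h, then to h after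
-- cancelling one factor 5. In the converse, `k` supplies the factor 2.
50∣k*n⇔25∣n : ∀ {k} n → + 2 ∣ k → ¬ + 5 ∣ k → + 50 ∣ k * n ⇔ + 25 ∣ n
50∣k*n⇔25∣n {k} n 2∣k 5∤k = mk⇔ forward (backward 2∣k)
  where
  forward : + 50 ∣ k * n → + 25 ∣ n
  forward 50∣kn with 5∣m*n⇒5∣n k n 5∤k (∣-trans (divides (+ 10) refl) 50∣kn)
  ... | divides h refl = *-monoˡ-∣ (+ 5) (5∣m*n⇒5∣n k h 5∤k (*-cancelˡ-∣ (+ 5) 25∣5kh))
    where
    rearrange : ∀ k h → k * (h * + 5) ≡ + 5 * (k * h)
    rearrange = solve-∀

    25∣5kh : + 25 ∣ + 5 * (k * h)
    25∣5kh = subst (+ 25 ∣_) (rearrange k h) (∣-trans (divides (+ 2) refl) 50∣kn)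

  backward : + 2 ∣ k → + 25 ∣ n → + 50 ∣ k * n
  backward (divides j refl) (divides h refl) = divides (j * h) (rearrange j h)
    where
    rearrange : ∀ j h → j * + 2 * (h * + 25) ≡ j * h * + 50
    rearrange = solve-∀

-- Turns a congruence into an equation that can be matched with `refl`, so that an entry is replaced
-- by its residue plus a multiple of 5.
≋⇒≡ : ∀ {x y m} → x ≋ y [mod m ] → ∃ λ q → x ≡ y + m * q
≋⇒≡ {x} {y} {m} (divides q eq) =
  q , trans (add-back x y) (trans (cong (λ z → y + z) eq) (cong (λ z → y + z) (*-comm q m)))
  where
  add-back : ∀ x y → x ≡ y + (x - y)
  add-back = solve-∀

∣-resp-≋ : ∀ {x y m} → x ≋ y [mod m ] → m ∣ x → m ∣ y
∣-resp-≋ {x} {y} x≋y m∣x = subst (_ ∣_) (cancel x y) (∣m∣n⇒∣m-n m∣x x≋y)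
  where
  cancel : ∀ x y → x - (x - y) ≡ y
  cancel = solve-∀

≋-sym : ∀ {x y m} → x ≋ y [mod m ] → y ≋ x [mod m ]
≋-sym {x} {y} x≋y = subst (_ ∣_) (flip x y) (∣m⇒∣-m x≋y)
  where
  flip : ∀ x y → - (x - y) ≡ y - x
  flip = solve-∀

-- Both 2 and 5 divide 10, so each claim depends only on `k` modulo 10 and is decided at the four
-- representatives.
even-and-prime-to-5 : ∀ {k} →
  k ≋ + 2 [mod + 10 ] ⊎ k ≋ - (+ 2) [mod + 10 ] ⊎ k ≋ + 4 [mod + 10 ] ⊎ k ≋ - (+ 4) [mod + 10 ] →
  + 2 ∣ k × ¬ + 5 ∣ k
even-and-prime-to-5 {k} =
  [ from-residue (divides 1ℤ refl) (from-no (+ 5 ∣? + 2))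
  , [ from-residue (divides -1ℤ refl) (from-no (+ 5 ∣? - (+ 2)))
    , [ from-residue (divides (+ 2) refl) (from-no (+ 5 ∣? + 4))
      , from-residue (divides (- (+ 2)) refl) (from-no (+ 5 ∣? - (+ 4))) ]′ ]′ ]′
  where
  from-residue : ∀ {r} → + 2 ∣ r → ¬ + 5 ∣ r → k ≋ r [mod + 10 ] → + 2 ∣ k × ¬ + 5 ∣ k
  from-residue {r} 2∣r 5∤r k≋r =
    ∣-resp-≋ (≋-sym {k} {r} (∣-trans (divides (+ 5) refl) k≋r)) 2∣r ,
    5∤r ∘ ∣-resp-≋ (∣-trans (divides (+ 2) refl) k≋r)

-- Numerators

InKernel : Mat₂ → Set
InKernel (mat a b c d) = FifthsCongruent b c ⊎ FifthsOpposite a d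

-- Modulo 25 the numerator is 5((p + qε) b′ + qε c′); the condition p ≡ −2qε (mod 5)
-- makes the coefficients of b′ and c′ opposite.
diagonal : ∀ p q ε r {a b c d} → p ≡ + 5 * r - + 2 * ε * q → ¬ + 5 ∣ q * ε →
  mat a b c d ≋ᴹ mat ε 0ℤ 0ℤ ε [mod + 5 ] →
  + 25 ∣ p * b + (q * a * b + q * c * d) ⇔ InKernel (mat a b c d)
diagonal p q ε r {a} {b} {c} {d} refl 5∤qε (a≋ε , b≋0 , c≋0 , d≋ε) = mk⇔ forward backward
  where
  expand : ∀ q ε r a′ b′ c′ d′ →
    (+ 5 * r - + 2 * ε * q) * (+ 5 * b′) +
      (q * (ε + + 5 * a′) * (+ 5 * b′) + q * (+ 5 * c′) * (ε + + 5 * d′))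
    ≡ + 5 * (- (q * ε) * (b′ - c′)) + + 25 * (r * b′ + q * (a′ * b′ + c′ * d′))
  expand = solve-∀

  -- The quotients are arbitrary here: `forward` takes them from the congruences modulo 5,
  -- `backward` from the given `FifthsCongruent` witness.
  criterion : ∀ b′ c′ → b ≡ + 5 * b′ → c ≡ + 5 * c′ →
    + 25 ∣ p * b + (q * a * b + q * c * d) ⇔ b′ ≋ c′ [mod + 5 ]
  criterion b′ c′ refl refl with ≋⇒≡ {a} a≋ε | ≋⇒≡ {d} d≋ε
  ... | a′ , refl | d′ , refl =
    subst (λ n → + 25 ∣ n ⇔ b′ ≋ c′ [mod + 5 ]) (sym (expand q ε r a′ b′ c′ d′))
      (25∣5m*x+25y⇔5∣x (- (q * ε)) (b′ - c′) _ (5∤qε ∘ ∣-m⇒∣m))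

  forward : + 25 ∣ p * b + (q * a * b + q * c * d) → InKernel (mat a b c d)
  forward h with ≋⇒≡ {b} {0ℤ} b≋0 | ≋⇒≡ {c} {0ℤ} c≋0
  ... | b′ , b≡ | c′ , c≡ =
    inj₁ (b′ , c′ , b≡5b′ , c≡5c′ , to (criterion b′ c′ b≡5b′ c≡5c′) h)
    where
    b≡5b′ = trans b≡ (+-identityˡ (+ 5 * b′))
    c≡5c′ = trans c≡ (+-identityˡ (+ 5 * c′))

  backward : InKernel (mat a b c d) → + 25 ∣ p * b + (q * a * b + q * c * d)
  backward (inj₁ (b′ , c′ , b≡ , c≡ , b′≋c′)) = from (criterion b′ c′ b≡ c≡) b′≋c′
  -- The other alternative is impossible: 5 would divide `a`, hence ε, as `a` ≡ ε modulo 5.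
  backward (inj₂ (a′ , _ , a≡ , _)) =
    contradiction (∣n⇒∣m*n q (∣-resp-≋ {a} a≋ε (subst (+ 5 ∣_) (sym a≡) (∣m⇒∣m*n a′ ∣-refl)))) 5∤qε

-- With -ε in the upper right corner, a′ gets the coefficient -qε, and d′ gets p + qε ≡ -qε (mod 5).
-- These agree, so the sum a′ + d′ appears instead of a difference. The summand 25 is the 5 in `g`
-- and `f` written over the denominator 5.
antidiagonal : ∀ p q ε r {a b c d} → p ≡ + 5 * r - + 2 * ε * q → ¬ + 5 ∣ q * ε →
  mat a b c d ≋ᴹ mat 0ℤ (- ε) ε 0ℤ [mod + 5 ] →
  + 25 ∣ (+ 25 + p * d) + (q * a * b + q * c * d) ⇔ InKernel (mat a b c d)
antidiagonal p q ε r {a} {b} {c} {d} refl 5∤qε (a≋0 , b≋-ε , c≋ε , d≋0) = mk⇔ forward backward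
  where
  expand : ∀ q ε r a′ b′ c′ d′ →
    (+ 25 + (+ 5 * r - + 2 * ε * q) * (+ 5 * d′)) +
      (q * (+ 5 * a′) * (- ε + + 5 * b′) + q * (ε + + 5 * c′) * (+ 5 * d′))
    ≡ + 5 * (- (q * ε) * (a′ - - d′)) + + 25 * (+ 1 + r * d′ + q * (a′ * b′ + c′ * d′))
  expand = solve-∀

  criterion : ∀ a′ d′ → a ≡ + 5 * a′ → d ≡ + 5 * d′ →
    + 25 ∣ (+ 25 + p * d) + (q * a * b + q * c * d) ⇔ a′ ≋ - d′ [mod + 5 ]
  criterion a′ d′ refl refl with ≋⇒≡ {b} b≋-ε | ≋⇒≡ {c} c≋ε
  ... | b′ , refl | c′ , refl =
    subst (λ n → + 25 ∣ n ⇔ a′ ≋ - d′ [mod + 5 ]) (sym (expand q ε r a′ b′ c′ d′))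
      (25∣5m*x+25y⇔5∣x (- (q * ε)) (a′ - - d′) _ (5∤qε ∘ ∣-m⇒∣m))

  forward : + 25 ∣ (+ 25 + p * d) + (q * a * b + q * c * d) → InKernel (mat a b c d)
  forward h with ≋⇒≡ {a} {0ℤ} a≋0 | ≋⇒≡ {d} {0ℤ} d≋0
  ... | a′ , a≡ | d′ , d≡ =
    inj₂ (a′ , d′ , a≡5a′ , d≡5d′ , to (criterion a′ d′ a≡5a′ d≡5d′) h)
    where
    a≡5a′ = trans a≡ (+-identityˡ (+ 5 * a′))
    d≡5d′ = trans d≡ (+-identityˡ (+ 5 * d′))

  backward : InKernel (mat a b c d) → + 25 ∣ (+ 25 + p * d) + (q * a * b + q * c * d)
  backward (inj₂ (a′ , d′ , a≡ , d≡ , a′≋-d′)) = from (criterion a′ d′ a≡ d≡) a′≋-d′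
  backward (inj₁ (_ , c′ , _ , c≡ , _)) =
    contradiction (∣n⇒∣m*n q (∣-resp-≋ {c} c≋ε (subst (+ 5 ∣_) (sym c≡) (∣m⇒∣m*n c′ ∣-refl)))) 5∤qε

-- Fractions

-- `x / 5` is `fromℚᵘ (ℚᵘ.mkℚᵘ x 4)`, the denominator being stored minus one. Working with unreduced
-- fractions makes equality a matter of cross-multiplication, free of gcds.
fromℚᵘ-homo-+ : ∀ p q → fromℚᵘ p ℚ.+ fromℚᵘ q ≡ fromℚᵘ (p ℚᵘ.+ q)
fromℚᵘ-homo-+ p q = ℚ.toℚᵘ-injective (begin
  toℚᵘ (fromℚᵘ p ℚ.+ fromℚᵘ q)              ≈⟨ ℚ.toℚᵘ-homo-+ (fromℚᵘ p) (fromℚᵘ q) ⟩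
  toℚᵘ (fromℚᵘ p) ℚᵘ.+ toℚᵘ (fromℚᵘ q)  ≈⟨ ℚᵘ.+-cong (ℚ.toℚᵘ-fromℚᵘ p) (ℚ.toℚᵘ-fromℚᵘ q) ⟩
  p ℚᵘ.+ q                                  ≈⟨ ℚ.toℚᵘ-fromℚᵘ (p ℚᵘ.+ q) ⟨
  toℚᵘ (fromℚᵘ (p ℚᵘ.+ q))              ∎)
  where open ≈-Reasoning ℚᵘ.≃-setoid

fromℚᵘ-homo-* : ∀ p q → fromℚᵘ p ℚ.* fromℚᵘ q ≡ fromℚᵘ (p ℚᵘ.* q)
fromℚᵘ-homo-* p q = ℚ.toℚᵘ-injective (begin
  toℚᵘ (fromℚᵘ p ℚ.* fromℚᵘ q)              ≈⟨ ℚ.toℚᵘ-homo-* (fromℚᵘ p) (fromℚᵘ q) ⟩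
  toℚᵘ (fromℚᵘ p) ℚᵘ.* toℚᵘ (fromℚᵘ q)  ≈⟨ ℚᵘ.*-cong (ℚ.toℚᵘ-fromℚᵘ p) (ℚ.toℚᵘ-fromℚᵘ q) ⟩
  p ℚᵘ.* q                                  ≈⟨ ℚ.toℚᵘ-fromℚᵘ (p ℚᵘ.* q) ⟨
  toℚᵘ (fromℚᵘ (p ℚᵘ.* q))              ∎)
  where open ≈-Reasoning ℚᵘ.≃-setoid

fromℚᵘ-homo-neg : ∀ p → ℚ.- fromℚᵘ p ≡ fromℚᵘ (ℚᵘ.- p)
fromℚᵘ-homo-neg p = ℚ.toℚᵘ-injective (begin
  toℚᵘ (ℚ.- fromℚᵘ p)      ≈⟨ ℚ.toℚᵘ-homo‿- (fromℚᵘ p) ⟩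
  ℚᵘ.- toℚᵘ (fromℚᵘ p)     ≈⟨ ℚᵘ.-‿cong (ℚ.toℚᵘ-fromℚᵘ p) ⟩
  ℚᵘ.- p                     ≈⟨ ℚ.toℚᵘ-fromℚᵘ (ℚᵘ.- p) ⟨
  toℚᵘ (fromℚᵘ (ℚᵘ.- p))   ∎)
  where open ≈-Reasoning ℚᵘ.≃-setoid

/5-homo-+ : ∀ x y → x / 5 ℚ.+ y / 5 ≡ (x + y) / 5
/5-homo-+ x y = trans (fromℚᵘ-homo-+ (ℚᵘ.mkℚᵘ x 4) (ℚᵘ.mkℚᵘ y 4))
  (ℚ.fromℚᵘ-cong {x = ℚᵘ.mkℚᵘ x 4 ℚᵘ.+ ℚᵘ.mkℚᵘ y 4} {y = ℚᵘ.mkℚᵘ (x + y) 4}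
    (ℚᵘ.*≡* (cross x y)))
  where
  cross : ∀ x y → (x * + 5 + y * + 5) * + 5 ≡ (x + y) * + 25
  cross = solve-∀

-- Captures what `g` and `f` have in common, so that a single kernel criterion serves both.
KernelNumerator : (Γθ₅ → ℚ) → Γθ₅ → Set
KernelNumerator h M = ∃ λ n → h M ≡ n / 5 × (+ 25 ∣ n ⇔ InKernel (Γθ₅.matrix M))

sum-of-fifths : ∀ x y z → x / 5 ℚ.+ (y / 5 ℚ.+ z / 5) ≡ (x + (y + z)) / 5
sum-of-fifths x y z = trans (cong (x / 5 ℚ.+_) (/5-homo-+ y z)) (/5-homo-+ x (y + z))

5+sum-of-fifths : ∀ x y z → (+ 5 / 1 ℚ.+ x / 5) ℚ.+ (y / 5 ℚ.+ z / 5) ≡ ((+ 25 + x) + (y + z)) / 5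
5+sum-of-fifths x y z =
  -- `+ 5 / 1` and `+ 25 / 5` have the same normal form.
  trans (cong (ℚ._+ (y / 5 ℚ.+ z / 5)) (/5-homo-+ (+ 25) x)) (sum-of-fifths (+ 25 + x) y z)

-- The sign moves onto the coefficient `p`, which makes the case of -S an instance of
-- `antidiagonal`.
5-sum-of-fifths : ∀ p x y z →
  (+ 5 / 1 ℚ.- (p * x) / 5) ℚ.+ (y / 5 ℚ.+ z / 5) ≡ ((+ 25 + - p * x) + (y + z)) / 5
5-sum-of-fifths p x y z = trans
  (cong (λ w → (+ 5 / 1 ℚ.+ w) ℚ.+ (y / 5 ℚ.+ z / 5))
    (trans (fromℚᵘ-homo-neg (ℚᵘ.mkℚᵘ (p * x) 4)) (cong (_/ 5) (neg-distribˡ-* p x))))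
  (5+sum-of-fifths (- p * x) y z)

-- In each case the numbers passed are p, q, the sign ε of the residue, and the r that solves p = 5r
-- - 2εq; for instance 24 = 5 · 4 + 2 · 2.
g-numerator : ∀ M → KernelNumerator g M
g-numerator record { element = E ; residue = ≋I h } =
  _ , sum-of-fifths (+ 6 * b) (+ 2 * a * b) (+ 2 * c * d) ,
  diagonal (+ 6) (+ 2) 1ℤ (+ 2) refl (from-no (+ 5 ∣? + 2)) h
  where open SL₂ℤ E
g-numerator record { element = E ; residue = ≋-I h } =
  _ , sum-of-fifths (+ 24 * b) (+ 2 * a * b) (+ 2 * c * d) ,
  diagonal (+ 24) (+ 2) -1ℤ (+ 4) refl (from-no (+ 5 ∣? - (+ 2))) h
  where open SL₂ℤ E
g-numerator record { element = E ; residue = ≋S h } =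
  _ , 5+sum-of-fifths (+ 6 * d) (+ 2 * a * b) (+ 2 * c * d) ,
  antidiagonal (+ 6) (+ 2) 1ℤ (+ 2) refl (from-no (+ 5 ∣? + 2)) h
  where open SL₂ℤ E
g-numerator record { element = E ; residue = ≋-S h } =
  _ , 5-sum-of-fifths (+ 6) d (+ 2 * a * b) (+ 2 * c * d) ,
  antidiagonal (- (+ 6)) (+ 2) -1ℤ (- (+ 2)) refl (from-no (+ 5 ∣? - (+ 2))) h
  where open SL₂ℤ E

-- Now q is 8 instead of 2, again prime to 5, and p changes accordingly. The resulting condition on
-- `M` is the same, which is why the two kernels coincide.
f-numerator : ∀ M → KernelNumerator f M
f-numerator record { element = E ; residue = ≋I h } =
  _ , sum-of-fifths (+ 4 * b) (+ 8 * a * b) (+ 8 * c * d) ,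
  diagonal (+ 4) (+ 8) 1ℤ (+ 4) refl (from-no (+ 5 ∣? + 8)) h
  where open SL₂ℤ E
f-numerator record { element = E ; residue = ≋-I h } =
  _ , sum-of-fifths (+ 6 * b) (+ 8 * a * b) (+ 8 * c * d) ,
  diagonal (+ 6) (+ 8) -1ℤ (- (+ 2)) refl (from-no (+ 5 ∣? - (+ 8))) h
  where open SL₂ℤ E
f-numerator record { element = E ; residue = ≋S h } =
  _ , 5+sum-of-fifths (+ 4 * d) (+ 8 * a * b) (+ 8 * c * d) ,
  antidiagonal (+ 4) (+ 8) 1ℤ (+ 4) refl (from-no (+ 5 ∣? + 8)) h
  where open SL₂ℤ E
f-numerator record { element = E ; residue = ≋-S h } =
  _ , 5-sum-of-fifths (+ 4) d (+ 8 * a * b) (+ 8 * c * d) ,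
  antidiagonal (- (+ 4)) (+ 8) -1ℤ (- (+ 4)) refl (from-no (+ 5 ∣? - (+ 8))) h
  where open SL₂ℤ E

-- The origin of 50: cross-multiplying kn/25 = 2j, with 25 from the two denominators and 2 from the
-- period 2πi.
fifths-product≡even⇔ : ∀ k n j → (k / 5) ℚ.* (n / 5) ≡ (+ 2 / 1) ℚ.* (j / 1) ⇔ k * n ≡ j * + 50
fifths-product≡even⇔ k n j = mk⇔ forward backward
  where
  P Q : ℚᵘ.ℚᵘ
  P = ℚᵘ.mkℚᵘ k 4 ℚᵘ.* ℚᵘ.mkℚᵘ n 4
  Q = ℚᵘ.mkℚᵘ (+ 2) 0 ℚᵘ.* ℚᵘ.mkℚᵘ j 0

  P≡ : (k / 5) ℚ.* (n / 5) ≡ fromℚᵘ P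
  P≡ = fromℚᵘ-homo-* (ℚᵘ.mkℚᵘ k 4) (ℚᵘ.mkℚᵘ n 4)

  Q≡ : (+ 2 / 1) ℚ.* (j / 1) ≡ fromℚᵘ Q
  Q≡ = fromℚᵘ-homo-* (ℚᵘ.mkℚᵘ (+ 2) 0) (ℚᵘ.mkℚᵘ j 0)

  regroup : ∀ j → + 2 * j * + 25 ≡ j * + 50
  regroup = solve-∀

  forward : (k / 5) ℚ.* (n / 5) ≡ (+ 2 / 1) ℚ.* (j / 1) → k * n ≡ j * + 50
  forward eq with ℚ.fromℚᵘ-injective {x = P} {y = Q} (trans (sym P≡) (trans eq Q≡))
  ... | ℚᵘ.*≡* kn*1≡2j*25 = trans (sym (*-identityʳ (k * n))) (trans kn*1≡2j*25 (regroup j))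

  backward : k * n ≡ j * + 50 → (k / 5) ℚ.* (n / 5) ≡ (+ 2 / 1) ℚ.* (j / 1)
  backward eq = trans P≡ (trans (ℚ.fromℚᵘ-cong {x = P} {y = Q} (ℚᵘ.*≡*
    (trans (*-identityʳ (k * n)) (trans eq (sym (regroup j)))))) (sym Q≡))

-- The exponential and its periods

module _ {ℓ ℓ₁ ℓ₂} (ℂ : ComplexExponential ℓ ℓ₁ ℓ₂) where
  private
    module ℂ = ComplexExponential ℂ
    open ℂ using (fromℚ; π; i; exp; _≈_; 0#; 1#; _#_; heytingCommutativeRing)
      renaming (_*_ to _·_)
    module R = CommutativeRing (HeytingCommutativeRing.commutativeRing heytingCommutativeRing)
    module H = HeytingProperties heytingCommutativeRing
    open RingProperties R.ring using (-‿distribˡ-*; -‿involutive)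
    open RingMorphisms ℚ.+-*-rawRing R.rawRing using (module IsRingMonomorphism)
    open IsRingMonomorphism ℂ.fromℚ-monomorphism using (*-homo; ⟦⟧-cong; injective)
    open ≈-Reasoning R.setoid

  -- From i² = -1, the inverse of `i` is -i, so `i` is apart from 0, and hence so is its product
  -- with `π`. Invertibility is phrased for differences, hence the `0#` being subtracted.
  π·i#0 : π · i # 0#
  π·i#0 = H.x#0y#0→xy#0 ℂ.π#0 (H.invertibleˡ⇒# (ℂ.- i , (begin
    ℂ.- i · (i R.- 0#)   ≈⟨ R.*-congˡ (H.x-0≈x i) ⟩
    ℂ.- i · i            ≈⟨ -‿distribˡ-* i i ⟨
    ℂ.- (i · i)          ≈⟨ R.-‿cong ℂ.i*i≈-1 ⟩
    ℂ.- (ℂ.- 1#)         ≈⟨ -‿involutive 1# ⟩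
    1#                   ∎)))

  π·i-cancel : ∀ {x y} → π · i · x ≈ π · i · y → x ≈ y
  π·i-cancel {x} {y} eq
    with u , u-inverse , _ ← HeytingCommutativeRing.#⇒invertible heytingCommutativeRing π·i#0 =
    begin
      x                    ≈⟨ undo x ⟨
      u · (π · i · x)      ≈⟨ R.*-congˡ eq ⟩
      u · (π · i · y)      ≈⟨ undo y ⟩
      y                    ∎
    where
    undo : ∀ z → u · (π · i · z) ≈ z
    undo z = begin
      u · (π · i · z)            ≈⟨ R.*-assoc u (π · i) z ⟨
      u · (π · i) · z            ≈⟨ R.*-congʳ (R.*-congˡ (H.x-0≈x (π · i))) ⟨
      u · (π · i R.- 0#) · z     ≈⟨ R.*-congʳ u-inverse ⟩
      1# · z                     ≈⟨ R.*-identityˡ z ⟩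
      z                          ∎

  exponent≈ : ∀ p q → π · i · fromℚ p · fromℚ q ≈ π · i · fromℚ (p ℚ.* q)
  exponent≈ p q = R.trans (R.*-assoc (π · i) (fromℚ p) (fromℚ q)) (R.*-congˡ (R.sym (*-homo p q)))

  -- Brings the period into the form of the exponent, with `π · i` in front, ready to be cancelled.
  period≈ : ∀ p q → fromℚ p · π · i · fromℚ q ≈ π · i · fromℚ (p ℚ.* q)
  period≈ p q = begin
    fromℚ p · π · i · fromℚ q      ≈⟨ R.*-congʳ (R.*-assoc (fromℚ p) π i) ⟩
    fromℚ p · (π · i) · fromℚ q    ≈⟨ R.*-congʳ (R.*-comm (fromℚ p) (π · i)) ⟩
    π · i · fromℚ p · fromℚ q      ≈⟨ exponent≈ p q ⟩
    π · i · fromℚ (p ℚ.* q)        ∎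

  -- By the kernel condition, the exponent must be a period. Cancelling `π · i` and using
  -- injectivity of `fromℚ` leaves an equation between rationals, whose integer j is the quotient of
  -- kn by 50.
  exp≈1⇔50∣k*n : ∀ k n → exp (π · i · fromℚ (k / 5) · fromℚ (n / 5)) ≈ 1# ⇔ + 50 ∣ k * n
  exp≈1⇔50∣k*n k n = mk⇔ forward backward
    where
    forward : exp (π · i · fromℚ (k / 5) · fromℚ (n / 5)) ≈ 1# → + 50 ∣ k * n
    forward eq with j , z≈ ← to (ℂ.exp-kernel _) eq =
      divides j (to (fifths-product≡even⇔ k n j) (injective (π·i-cancel (begin
        π · i · fromℚ ((k / 5) ℚ.* (n / 5))           ≈⟨ exponent≈ (k / 5) (n / 5) ⟨
        π · i · fromℚ (k / 5) · fromℚ (n / 5)     ≈⟨ z≈ ⟩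
        fromℚ (+ 2 / 1) · π · i · fromℚ (j / 1)   ≈⟨ period≈ (+ 2 / 1) (j / 1) ⟩
        π · i · fromℚ ((+ 2 / 1) ℚ.* (j / 1))         ∎))))

    backward : + 50 ∣ k * n → exp (π · i · fromℚ (k / 5) · fromℚ (n / 5)) ≈ 1#
    backward (divides j eq) = from (ℂ.exp-kernel _) (j , (begin
      π · i · fromℚ (k / 5) · fromℚ (n / 5)     ≈⟨ exponent≈ (k / 5) (n / 5) ⟩
      π · i · fromℚ ((k / 5) ℚ.* (n / 5))           ≈⟨ R.*-congˡ (⟦⟧-cong (from (fifths-product≡even⇔ k n j) eq)) ⟩
      π · i · fromℚ ((+ 2 / 1) ℚ.* (j / 1))         ≈⟨ period≈ (+ 2 / 1) (j / 1) ⟨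
      fromℚ (+ 2 / 1) · π · i · fromℚ (j / 1)   ∎))

  kernel-criterion : ∀ h M k → KernelNumerator h M → + 2 ∣ k → ¬ + 5 ∣ k →
    exp (π · i · fromℚ (k / 5) · fromℚ (h M)) ≈ 1# ⇔ InKernel (Γθ₅.matrix M)
  kernel-criterion h M k (n , hM≡n/5 , 25∣n⇔) 2∣k 5∤k =
    subst (λ x → exp (π · i · fromℚ (k / 5) · fromℚ x) ≈ 1# ⇔ InKernel (Γθ₅.matrix M)) (sym hM≡n/5)
      (25∣n⇔ ⇔-∘ (50∣k*n⇔25∣n n 2∣k 5∤k ⇔-∘ exp≈1⇔50∣k*n k n))

mainTheorem12 : {ℓ ℓ₁ ℓ₂ : Level} (ℂ : ComplexExponential ℓ ℓ₁ ℓ₂) →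
    let open Multipliers ℂ in
    (k : ℤ) →
    k ≋ + 2 [mod + 10 ] ⊎ k ≋ - (+ 2) [mod + 10 ] ⊎ k ≋ + 4 [mod + 10 ] ⊎ k ≋ - (+ 4) [mod + 10 ] →
    (Ker (νG^ k) ≐ (λ M → let open Γθ₅ M in FifthsCongruent b c ⊎ FifthsOpposite a d)) ×
    (Ker (νG^ k) ≐ Ker (νF^ k))
mainTheorem12 ℂ k k≋ =
  ((λ {M} → to (kerG M)) , λ {M} → from (kerG M)) ,
  ((λ {M} → from (kerF M) ∘ to (kerG M)) , λ {M} → from (kerG M) ∘ to (kerF M))
  where
  open Multipliers ℂ

  kerG : ∀ M → Ker (νG^ k) M ⇔ InKernel (Γθ₅.matrix M)
  kerG M with 2∣k , 5∤k ← even-and-prime-to-5 {k} k≋ = kernel-criterion ℂ g M k (g-numerator M) 2∣k 5∤k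

  kerF : ∀ M → Ker (νF^ k) M ⇔ InKernel (Γθ₅.matrix M)
  kerF M with 2∣k , 5∤k ← even-and-prime-to-5 {k} k≋ = kernel-criterion ℂ f M k (f-numerator M) 2∣k 5∤k
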